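{- Let $d$ be a positive integer, let $D>1$ be a squarefree integer, and let $\varepsilon_D$ be the fundamental unit of the real quadratic field $K=\mathbb{Q}(\sqrt{D})$, with ring of integers $\mathcal{O}_K$. Denote by $n$ the order of the class of $\varepsilon_D$ in the unit group $\mathcal{U}(\mathcal{O}_K/d\mathcal{O}_K)$ and define the set $$\mathcal{H}=\left\{k\in\{0,\dots,n\} : \varepsilon_D^{4k}+\varepsilon_D^{2k}+1\equiv 0 \pmod{d\,\mathcal{O}_K}\right\}.$$ Then $$\mathcal{GP}_{(1,1,1,d)}(\mathbb{Q}(\sqrt{D}))=\bigcup_{k\in\mathcal{H}}\ \bigcup_{z\in\mathbb{Z}}\left\{(\pm\beta,\,\beta\gamma,\,\pm\beta\gamma^2) : \gamma=\varepsilon_D^{nz+k},\ \beta=\frac{1}{d}\sum_{j=0}^{2}\gamma^{1-2j}\right\}.$$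
   Context: For a number field $K$ with ring of integers $\mathcal{O}_K$ and $a,b,c,d\in\mathcal{O}_K$, $\mathcal{GP}_{(a,b,c,d)}(K)$ denotes the set of non-trivial triples $(x,y,z)\in\mathcal{O}_K^3$ in geometric progression satisfying $ax^2+by^2+cz^2=dxyz$. Here $(x,y,z)$ is in geometric progression over $\mathcal{O}_K$ if there exist $\alpha,\beta\in\mathcal{O}_K$ with $x=\alpha$, $y=\alpha\beta$, $z=\alpha\beta^2$; it is non-trivial if $\alpha\neq 0$ (i.e. $(x,y,z)\neq(0,0,0)$). The notation $(\pm r,s,\pm t)$ stands for the two triples $(r,s,t)$ and $(-r,s,-t)$ (same sign in both places). The fundamental unit $\varepsilon_D$ satisfies $\mathcal{U}(\mathcal{O}_K)=\{\pm\varepsilon_D^k : k\in\mathbb{Z}\}$, where $\mathcal{U}(R)$ denotes the group of units of a ring $R$. If $d=1$, then $n=1$ by convention. -}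

module Defs where

open import Algebra.Bundles using (CommutativeRing)
open import Algebra.Structures using (IsCommutativeRing)
open import Data.Fin.Base using (Fin; toℕ)
open import Data.Integer.Base as ℤ using (ℤ; +_; -[1+_])
open import Data.Nat.Base as ℕ using (ℕ; suc; NonZero)
import Data.Nat.Divisibility as ℕ
open import Data.Product using (Σ-syntax; ∃-syntax; _×_; _,_)
open import Data.Rational as ℚ using (ℚ; 0ℚ; 1ℚ)
open import Data.Rational.Properties using (_≟_)
open import Data.Rational.Solver using (module +-*-Solver)
open import Data.Sum.Base using (_⊎_)
open import Level using (0ℓ)
open import Relation.Binary.PropositionalEquality
  using (_≡_; _≢_; refl; cong₂; isEquivalence)
open import Relation.Nullary.Decidable using (yes; no)
open import Relation.Unary using (Pred; _∈_; _≐_; ⋃)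

Squarefree : ℕ → Set
Squarefree D = ∀ m → m ℕ.* m ℕ.∣ D → m ≡ 1

-- `p +√ q` is p + q√D.  This is the field ℚ(√D) when D is not a perfect
-- square, in particular when D > 1 is squarefree.
record ℚ√ (D : ℕ) : Set where
  constructor _+√_
  field
    rat  : ℚ
    surd : ℚ

open ℚ√ public

module _ {D : ℕ} where

  δ : ℚ
  δ = + D ℚ./ 1

  infix  4 _≡_mod_
  infixl 6 _+_ _-_
  infixl 7 _*_
  infix  8 -_ _⁻¹
  infixr 8 _^ℤ_

  ι : ℚ → ℚ√ D
  ι r = r +√ 0ℚ

  0K 1K : ℚ√ D
  0K = ι 0ℚ
  1K = ι 1ℚ

  -_ : ℚ√ D → ℚ√ D
  -_ (p +√ q) = (ℚ.- p) +√ (ℚ.- q)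

  _+_ _-_ _*_ : ℚ√ D → ℚ√ D → ℚ√ D
  (p +√ q) + (r +√ s) = (p ℚ.+ r) +√ (q ℚ.+ s)
  x - y = x + (- y)
  (p +√ q) * (r +√ s) = (p ℚ.* r ℚ.+ δ ℚ.* (q ℚ.* s)) +√ (p ℚ.* s ℚ.+ q ℚ.* r)

  isCommutativeRing : IsCommutativeRing _≡_ _+_ _*_ -_ 0K 1K
  isCommutativeRing = record
    { isRing = record
      { +-isAbelianGroup = record
        { isGroup = record
          { isMonoid = record
            { isSemigroup = record
              { isMagma = record
                { isEquivalence = isEquivalence
                ; ∙-cong = cong₂ _+_
                }
              ; assoc = λ (a +√ b) (c +√ d) (e +√ f) →
                  cong₂ _+√_ (+-assoc a c e) (+-assoc b d f)
              }
            ; identity = (λ (a +√ b) → cong₂ _+√_ (+-identityˡ a) (+-identityˡ b))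
                       , (λ (a +√ b) → cong₂ _+√_ (+-identityʳ a) (+-identityʳ b))
            }
          ; inverse = (λ (a +√ b) → cong₂ _+√_ (+-inverseˡ a) (+-inverseˡ b))
                    , (λ (a +√ b) → cong₂ _+√_ (+-inverseʳ a) (+-inverseʳ b))
          ; ⁻¹-cong = λ { refl → refl }
          }
        ; comm = λ (a +√ b) (c +√ d) → cong₂ _+√_ (+-comm a c) (+-comm b d)
        }
      ; *-cong = cong₂ _*_
      ; *-assoc = λ (a +√ b) (c +√ d) (e +√ f) → cong₂ _+√_
          (solve 7 (λ t a b c d e f →
             (a :* c :+ t :* (b :* d)) :* e :+ t :* ((a :* d :+ b :* c) :* f)
             := a :* (c :* e :+ t :* (d :* f)) :+ t :* (b :* (c :* f :+ d :* e)))
             refl δ a b c d e f)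
          (solve 7 (λ t a b c d e f →
             (a :* c :+ t :* (b :* d)) :* f :+ (a :* d :+ b :* c) :* e
             := a :* (c :* f :+ d :* e) :+ b :* (c :* e :+ t :* (d :* f)))
             refl δ a b c d e f)
      ; *-identity =
            (λ (a +√ b) → cong₂ _+√_
              (solve 3 (λ t a b → con 1ℚ :* a :+ t :* (con 0ℚ :* b) := a) refl δ a b)
              (solve 2 (λ a b → con 1ℚ :* b :+ con 0ℚ :* a := b) refl a b))
          , (λ (a +√ b) → cong₂ _+√_
              (solve 3 (λ t a b → a :* con 1ℚ :+ t :* (b :* con 0ℚ) := a) refl δ a b)
              (solve 2 (λ a b → a :* con 0ℚ :+ b :* con 1ℚ := b) refl a b))
      ; distrib =
            (λ (a +√ b) (c +√ d) (e +√ f) → cong₂ _+√_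
              (solve 7 (λ t a b c d e f →
                 a :* (c :+ e) :+ t :* (b :* (d :+ f))
                 := (a :* c :+ t :* (b :* d)) :+ (a :* e :+ t :* (b :* f)))
                 refl δ a b c d e f)
              (solve 6 (λ a b c d e f →
                 a :* (d :+ f) :+ b :* (c :+ e)
                 := (a :* d :+ b :* c) :+ (a :* f :+ b :* e))
                 refl a b c d e f))
          , (λ (a +√ b) (c +√ d) (e +√ f) → cong₂ _+√_
              (solve 7 (λ t a b c d e f →
                 (c :+ e) :* a :+ t :* ((d :+ f) :* b)
                 := (c :* a :+ t :* (d :* b)) :+ (e :* a :+ t :* (f :* b)))
                 refl δ a b c d e f)
              (solve 6 (λ a b c d e f →
                 (c :+ e) :* b :+ (d :+ f) :* a
                 := (c :* b :+ d :* a) :+ (e :* b :+ f :* a))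
                 refl a b c d e f))
      }
    ; *-comm = λ (a +√ b) (c +√ d) → cong₂ _+√_
        (solve 5 (λ t a b c d →
           a :* c :+ t :* (b :* d) := c :* a :+ t :* (d :* b)) refl δ a b c d)
        (solve 4 (λ a b c d → a :* d :+ b :* c := c :* b :+ d :* a) refl a b c d)
    }
    where
    open import Data.Rational.Properties
    open +-*-Solver

  commutativeRing : CommutativeRing 0ℓ 0ℓ
  commutativeRing = record { isCommutativeRing = isCommutativeRing }

  open CommutativeRing commutativeRing using (semiring; +-monoid)
  open import Algebra.Properties.Semiring.Exp semiring public using (_^_)
  open import Algebra.Properties.Monoid.Sum +-monoid public using (sum; sum-syntax)

  norm : ℚ√ D → ℚ
  norm (p +√ q) = p ℚ.* p ℚ.- δ ℚ.* (q ℚ.* q)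

  -- Inverse as conjugate over norm; for D not a perfect square the norm
  -- vanishes only at 0, and 0 ⁻¹ is 0.
  _⁻¹ : ℚ√ D → ℚ√ D
  x@(p +√ q) ⁻¹ with norm x ≟ 0ℚ
  ... | yes _   = 0K
  ... | no  N≢0 = ι (ℚ.1/_ (norm x) {{ℚ.≢-nonZero N≢0}}) * (p +√ (ℚ.- q))

  _^ℤ_ : ℚ√ D → ℤ → ℚ√ D
  x ^ℤ (+ m)    = x ^ m
  x ^ℤ -[1+ m ] = (x ⁻¹) ^ suc m

  -- Algebraic integers: roots of monic polynomials
  -- X^m + c_{m-1} X^{m-1} + … + c_0 with integer coefficients.
  𝒪 : Pred (ℚ√ D) 0ℓ
  𝒪 x = ∃[ m ] Σ[ c ∈ (Fin m → ℤ) ]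
    x ^ m + ∑[ i < m ] (ι (c i ℚ./ 1) * x ^ toℕ i) ≡ 0K

  𝒰 : Pred (ℚ√ D) 0ℓ
  𝒰 u = u ∈ 𝒪 × ∃[ v ] v ∈ 𝒪 × u * v ≡ 1K

  -- Determines ε up to replacing it by ± ε^{±1}.
  IsFundamentalUnit : Pred (ℚ√ D) 0ℓ
  IsFundamentalUnit ε = 𝒰 ≐ λ u → ∃[ k ] (u ≡ ε ^ℤ k ⊎ u ≡ - (ε ^ℤ k))

  -- Equality of classes in 𝒪 / d𝒪, for x and y in 𝒪.
  _≡_mod_ : ℚ√ D → ℚ√ D → ℕ → Set
  x ≡ y mod d = ∃[ w ] w ∈ 𝒪 × x - y ≡ ι (+ d ℚ./ 1) * w

  -- For u a unit of 𝒪, the order of its class in the unit group of 𝒪 / d𝒪.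
  -- For d = 1 the quotient is the zero ring and the order is 1.
  IsOrderOfClass : (d : ℕ) → ℚ√ D → ℕ → Set
  IsOrderOfClass d u n =
    1 ℕ.≤ n × u ^ n ≡ 1K mod d × (∀ m → 1 ℕ.≤ m → u ^ m ≡ 1K mod d → n ℕ.≤ m)

  Triple : Set
  Triple = ℚ√ D × ℚ√ D × ℚ√ D

  NontrivialGeometric : Pred Triple 0ℓ
  NontrivialGeometric (x , y , z) =
    ∃[ α ] ∃[ β ] α ∈ 𝒪 × β ∈ 𝒪 × α ≢ 0K
      × x ≡ α × y ≡ α * β × z ≡ α * β ^ 2

  𝒢𝒫 : (a b c d : ℚ√ D) → Pred Triple 0ℓ
  𝒢𝒫 a b c d t@(x , y , z) =
    (x ∈ 𝒪 × y ∈ 𝒪 × z ∈ 𝒪) × NontrivialGeometric t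
      × a * x ^ 2 + b * y ^ 2 + c * z ^ 2 ≡ d * x * y * z

  ℋ : (d : ℕ) (ε : ℚ√ D) (n : ℕ) → Pred ℕ 0ℓ
  ℋ d ε n k = k ℕ.≤ n
    × (ε ^ (4 ℕ.* k) + ε ^ (2 ℕ.* k) + 1K) ≡ 0K mod d

  β[_] : (d : ℕ) .{{_ : NonZero d}} → ℚ√ D → ℚ√ D
  β[ d ] γ = ι (+ 1 ℚ./ d) * ∑[ j < 3 ] (γ ^ℤ (+ 1 ℤ.- + (2 ℕ.* toℕ j)))

  -- {(± β, βγ, ± βγ²)} with the same sign in both places.
  signPair : (β γ : ℚ√ D) → Pred Triple 0ℓ
  signPair β γ t = t ≡ (β , β * γ , β * γ ^ 2)
                 ⊎ t ≡ (- β , β * γ , - (β * γ ^ 2))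

  solutionSet : (d : ℕ) .{{_ : NonZero d}} (ε : ℚ√ D) (n : ℕ) → Pred Triple 0ℓ
  solutionSet d ε n =
    ⋃[ (k , _) ∶ (∃[ k ] k ∈ ℋ d ε n) ] ⋃[ z ∶ ℤ ]
      (let γ = ε ^ℤ (+ n ℤ.* z ℤ.+ + k) in signPair (β[ d ] γ) γ)

{-# OPTIONS --safe #-}
module Submission where

-- Why the theorem holds.  Write T(y) = y⁴ + y² + 1.  For a triple
-- (α, αβ, αβ²) the equation reads α² T(β) = α² d α β³, and since D is not a
-- square, K = ℚ(√D) is a field and α² cancels, leaving T(β) = d α β³
-- (solves-geometric, geometric-solves).
-- Read as β (d α β² - β - β³) = 1, this makes the ratio of a solution a unit
-- of 𝒪 (ratio-inverse), hence ± ε^m.  The sign of β can be absorbed in α, because T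
-- is even.  For γ = ε^m the equation T(γ) = d α γ³ has the single solution
-- α = (γ + γ⁻¹ + γ⁻³) / d in K (firstTerm-equation, firstTerm-unique), which
-- lies in 𝒪 exactly when d divides T(γ) in 𝒪.  Writing m = n z + k with
-- 0 ≤ k < n, the factor ε^(n z) is 1 modulo d and so does not change the class
-- of T (T-congruence), which leaves the condition k ∈ ℋ.  Finally T has no zero
-- in K, as s² + s + 1 = 0 has no solution in a real field, so that α ≠ 0.
--
-- All this uses that 𝒪, defined through monic integer polynomials of any
-- degree, is a ring.  The proof goes through almost integral elements: x is
-- almost integral when the powers of x have a common denominator with respect
-- to the lattice ℤ + ℤ√D.  An algebraic integer is almost integral, since all
-- its powers are integer combinations of finitely many of them; almost integral
-- elements are visibly closed under sum, product and conjugation; and a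
-- rational one is an integer.  So the trace and the norm of an almost integral
-- x are integers, and x is a root of a monic integer quadratic.

open import Algebra.Bundles using (CommutativeRing)
import Algebra.Solver.Ring.NaturalCoefficients.Default as NaturalSolver
open import Data.Fin.Base using (Fin; toℕ; zero; suc)
import Data.Fin.Properties as Finₚ
open import Data.Nat.Base as ℕ using (ℕ; zero; suc; _<_; NonZero; s≤s; z≤n)
import Data.Nat.Properties as ℕₚ
open import Data.Product using (∃-syntax; _×_; _,_; proj₁; proj₂)
open import Data.Sum.Base using (_⊎_; inj₁; inj₂)
open import Level using (0ℓ)
open import Relation.Binary.PropositionalEquality as ≡ using (_≡_)

-- Identities in abstract commutative rings

module RingIdentities (R : CommutativeRing 0ℓ 0ℓ) where
  open CommutativeRing R
  open import Algebra.Properties.Semiring.Exp semiring using (_^_)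
  open NaturalSolver commutativeSemiring using (solve; con; _:*_; _:+_; _:=_)

  -- (X - x)(X - y) vanishes at x
  root-of-product : ∀ x y → x ^ 2 + (x * y * 1# + (- (x + y) * x ^ 1 + 0#)) ≈ 0#
  root-of-product x y = trans (factor x y (- (x + y)))
    (trans (*-congʳ (-‿inverseʳ (x + y))) (zeroˡ x))
    where
    factor : ∀ x y m → x * (x * 1#) + (x * y * 1# + (m * (x * 1#) + 0#)) ≈ (x + y + m) * x
    factor = solve 3 (λ x y m →
      x :* (x :* con 1) :+ (x :* y :* con 1 :+ (m :* (x :* con 1) :+ con 0)) := (x :+ y :+ m) :* x) refl

-- Almost integral elements of a commutative ring

module AlmostIntegrality (R : CommutativeRing 0ℓ 0ℓ) where
  open CommutativeRing R hiding (zero)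
  open import Algebra.Properties.CommutativeSemigroup *-commutativeSemigroup using (interchange)
  open import Algebra.Properties.CommutativeSemiring.Exp commutativeSemiring
  open import Algebra.Properties.Monoid.Sum +-monoid using (sum; sum-syntax)
  open import Algebra.Properties.Group +-group using () renaming (inverseˡ-unique to neg-unique)
  open import Relation.Binary.Reasoning.Setoid setoid
  open NaturalSolver commutativeSemiring using (solve; _:*_; _:+_; _:=_)

  -- L is closed under the operations of R, except perhaps for 1, and nat is a
  -- multiplicative map from ℕ to L such that every element of R has a nonzero
  -- denominator.  In the application R is ℚ(√D), L is ℤ + ℤ√D, and nat is the
  -- embedding of ℕ.
  module WithLattice
    (L : Carrier → Set)
    (L-resp : ∀ {x y} → x ≈ y → L x → L y)
    (L-0 : L 0#)
    (L-+ : ∀ {x y} → L x → L y → L (x + y))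
    (L-neg : ∀ {x} → L x → L (- x))
    (L-* : ∀ {x y} → L x → L y → L (x * y))
    (nat : ℕ → Carrier)
    (L-nat : ∀ e → L (nat e))
    (nat-* : ∀ a b → nat (a ℕ.* b) ≈ nat a * nat b)
    (denominator : ∀ x → ∃[ e ] NonZero e × L (nat e * x))
    where

    -- All powers of x have a common nonzero denominator.
    AlmostIntegral : Carrier → Set
    AlmostIntegral x = ∃[ e ] NonZero e × (∀ k → L (nat e * x ^ k))

    private
      expand-sum-power : ∀ e x y a b p →
        e * ((x * a) * b * p) + e * (a * (y * b) * p) ≈ e * (a * b * ((x + y) * p))
      expand-sum-power = solve 6 (λ e x y a b p →
        e :* ((x :* a) :* b :* p) :+ e :* (a :* (y :* b) :* p) := e :* (a :* b :* ((x :+ y) :* p))) refl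

      swap-factors : ∀ a b c d → c * (a * (b * d)) ≈ a * b * (c * d)
      swap-factors = solve 4 (λ a b c d → c :* (a :* (b :* d)) := a :* b :* (c :* d)) refl

      nat-product : ∀ a b x → nat a * (nat b * x) ≈ nat (a ℕ.* b) * x
      nat-product a b x = trans (sym (*-assoc (nat a) (nat b) x)) (*-congʳ (sym (nat-* a b)))

    L-sum : ∀ {m} (f : Fin m → Carrier) y → (∀ i → L (y * f i)) → L (y * sum f)
    L-sum {zero} f y h = L-resp (sym (zeroʳ y)) L-0
    L-sum {suc m} f y h = L-resp (sym (distribˡ y (f zero) _))
      (L-+ (h zero) (L-sum (λ i → f (suc i)) y (λ i → h (suc i))))

    common-denominator : ∀ (f : ℕ → Carrier) m → ∃[ e ] NonZero e × (∀ i → i < m → L (nat e * f i))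
    common-denominator f zero = 1 , _ , λ i ()
    common-denominator f (suc m) with common-denominator f m | denominator (f m)
    ... | a , a≢0 , ha | b , b≢0 , hb = b ℕ.* a , ℕₚ.m*n≢0 b a {{b≢0}} {{a≢0}} , h
      where
      h : ∀ i → i < suc m → L (nat (b ℕ.* a) * f i)
      h i i<1+m with ℕₚ.m<1+n⇒m<n∨m≡n i<1+m
      ... | inj₁ i<m = L-resp (nat-product b a (f i)) (L-* (L-nat b) (ha i i<m))
      ... | inj₂ ≡.refl = L-resp
              (trans (nat-product a b (f i)) (*-congʳ (reflexive (≡.cong nat (ℕₚ.*-comm a b)))))
              (L-* (L-nat a) hb)

    -- A common denominator of 1, x, …, x^(m-1) is one of every power of x, since
    -- x^(m+k) is a combination of x^k, …, x^(m+k-1) with coefficients in L.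
    integral⇒almostIntegral : ∀ {x} m (c : Fin m → Carrier) → (∀ i → L (c i)) →
      x ^ m + ∑[ i < m ] (c i * x ^ toℕ i) ≈ 0# → AlmostIntegral x
    integral⇒almostIntegral {x} m c L-c root with common-denominator (x ^_) m
    ... | e , e≢0 , initial = e , e≢0 , λ k → below (suc k) k (ℕₚ.m≤n+m (suc k) m)
      where
      below : ∀ k i → i < m ℕ.+ k → L (nat e * x ^ i)
      below zero i i<m = initial i (≡.subst (i <_) (ℕₚ.+-identityʳ m) i<m)
      below (suc k) i i<m+1+k with ℕₚ.m<1+n⇒m<n∨m≡n (≡.subst (i <_) (ℕₚ.+-suc m k) i<m+1+k)
      ... | inj₁ i<m+k = below k i i<m+k
      ... | inj₂ ≡.refl = L-resp (sym leading) (L-neg (L-sum (λ j → c j * x ^ toℕ j) y term))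
        where
        y = nat e * x ^ k
        S = ∑[ j < m ] (c j * x ^ toℕ j)
        term : ∀ j → L (y * (c j * x ^ toℕ j))
        term j = L-resp
          (trans (*-congˡ (*-congˡ (^-homo-* x k (toℕ j)))) (swap-factors (nat e) (x ^ k) (c j) (x ^ toℕ j)))
          (L-* (L-c j) (below k (k ℕ.+ toℕ j)
            (≡.subst (k ℕ.+ toℕ j <_) (ℕₚ.+-comm k m) (ℕₚ.+-monoʳ-< k (Finₚ.toℕ<n j)))))
        leading : nat e * x ^ (m ℕ.+ k) ≈ - (y * S)
        leading = neg-unique _ _ (begin
          nat e * x ^ (m ℕ.+ k) + y * S   ≈⟨ +-congʳ (*-congˡ (^-congʳ x (ℕₚ.+-comm m k))) ⟩
          nat e * x ^ (k ℕ.+ m) + y * S   ≈⟨ +-congʳ (*-congˡ (^-homo-* x k m)) ⟩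
          nat e * (x ^ k * x ^ m) + y * S ≈⟨ +-congʳ (*-assoc (nat e) (x ^ k) (x ^ m)) ⟨
          y * x ^ m + y * S               ≈⟨ distribˡ y (x ^ m) S ⟨
          y * (x ^ m + S)                 ≈⟨ *-congˡ root ⟩
          y * 0#                          ≈⟨ zeroʳ y ⟩
          0#                              ∎)

    almostIntegral-+ : ∀ {x y} → AlmostIntegral x → AlmostIntegral y → AlmostIntegral (x + y)
    almostIntegral-+ {x} {y} (a , a≢0 , ha) (b , b≢0 , hb) = a ℕ.* b , ℕₚ.m*n≢0 a b {{a≢0}} {{b≢0}} , λ k →
      L-resp (*-congˡ (trans (*-congʳ (*-identityˡ 1#)) (*-identityˡ _))) (mixed k 0 0)
      where
      -- The general i and j, of which only 0 is wanted, let the induction on k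
      -- replace one factor x + y by x or by y, with no binomial expansion.
      mixed : ∀ k i j → L (nat (a ℕ.* b) * (x ^ i * y ^ j * (x + y) ^ k))
      mixed zero i j = L-resp
        (trans (interchange (nat a) (x ^ i) (nat b) (y ^ j)) (*-cong (sym (nat-* a b)) (sym (*-identityʳ _))))
        (L-* (ha i) (hb j))
      mixed (suc k) i j = L-resp
        (expand-sum-power (nat (a ℕ.* b)) x y (x ^ i) (y ^ j) ((x + y) ^ k))
        (L-+ (mixed k (suc i) j) (mixed k i (suc j)))

    almostIntegral-* : ∀ {x y} → AlmostIntegral x → AlmostIntegral y → AlmostIntegral (x * y)
    almostIntegral-* {x} {y} (a , a≢0 , ha) (b , b≢0 , hb) = a ℕ.* b , ℕₚ.m*n≢0 a b {{a≢0}} {{b≢0}} , λ k →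
      L-resp
        (trans (interchange (nat a) (x ^ k) (nat b) (y ^ k)) (*-cong (sym (nat-* a b)) (sym (^-distrib-* x y k))))
        (L-* (ha k) (hb k))

-- The equation x² + y² + z² = d x y z on geometric progressions

module GeometricSolutions (R : CommutativeRing 0ℓ 0ℓ) where
  open CommutativeRing R hiding (zero)
  open import Algebra.Properties.CommutativeSemigroup *-commutativeSemigroup using (interchange)
  open import Algebra.Properties.Semiring.Exp semiring
  open import Algebra.Properties.CommutativeSemiring.Exp commutativeSemiring using (^-distrib-*)
  open import Algebra.Properties.Ring ring using (-‿distribˡ-*; -‿distribʳ-*; -‿involutive; -0#≈0#)
  open import Relation.Binary.Reasoning.Setoid setoid
  open NaturalSolver commutativeSemiring using (solve; con; _:*_; _:+_; _:^_; _:=_)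

  1^ : ∀ k → 1# ^ k ≈ 1#
  1^ zero = refl
  1^ (suc k) = trans (*-identityˡ _) (1^ k)

  unit-^ : ∀ {u v} → u * v ≈ 1# → ∀ k → u ^ k * v ^ k ≈ 1#
  unit-^ {u} {v} uv≈1 k = trans (sym (^-distrib-* u v k)) (trans (^-congˡ k uv≈1) (1^ k))

  inverse-unique : ∀ {u v w} → u * v ≈ 1# → u * w ≈ 1# → v ≈ w
  inverse-unique {u} {v} {w} uv≈1 uw≈1 = begin
    v           ≈⟨ *-identityˡ v ⟨
    1# * v      ≈⟨ *-congʳ uw≈1 ⟨
    u * w * v   ≈⟨ solve 3 (λ u v w → u :* w :* v := w :* (u :* v)) refl u v w ⟩
    w * (u * v) ≈⟨ *-congˡ uv≈1 ⟩
    w * 1#      ≈⟨ *-identityʳ w ⟩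
    w           ∎

  cancel-unit : ∀ {u v x y} → u * v ≈ 1# → u * x ≈ u * y → x ≈ y
  cancel-unit {u} {v} {x} {y} uv≈1 ux≈uy = begin
    x           ≈⟨ expand x ⟩
    v * (u * x) ≈⟨ *-congˡ ux≈uy ⟩
    v * (u * y) ≈⟨ expand y ⟨
    y           ∎
    where
    expand : ∀ x → x ≈ v * (u * x)
    expand x = trans (sym (*-identityˡ x)) (trans (*-congʳ (sym uv≈1))
      (solve 3 (λ u v x → u :* v :* x := v :* (u :* x)) refl u v x))

  unit-cancels : ∀ {u v} → u * v ≈ 1# → ∀ x y → (u * x) * (v * y) ≈ x * y
  unit-cancels {u} {v} uv≈1 x y = trans (interchange u x v y)
    (trans (*-congʳ uv≈1) (*-identityˡ (x * y)))

  -- The polynomial that the equation for (α, αβ, αβ²) has on its left side, up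
  -- to the factor α².
  T : Carrier → Carrier
  T y = y ^ 4 + y ^ 2 + 1#

  T-cong : ∀ {x y} → x ≈ y → T x ≈ T y
  T-cong x≈y = +-congʳ (+-cong (^-congˡ 4 x≈y) (^-congˡ 2 x≈y))

  T-of-power : ∀ x k → T (x ^ k) ≈ x ^ (4 ℕ.* k) + x ^ (2 ℕ.* k) + 1#
  T-of-power x k = +-congʳ (+-cong (power 4) (power 2))
    where
    power : ∀ m → (x ^ k) ^ m ≈ x ^ (m ℕ.* k)
    power m = trans (^-assocʳ x k m) (^-congʳ x (ℕₚ.*-comm k m))

  neg-square : ∀ x → (- x) ^ 2 ≈ x ^ 2
  neg-square x = begin
    - x * (- x * 1#) ≈⟨ *-congˡ (*-identityʳ (- x)) ⟩
    - x * - x        ≈⟨ -‿distribˡ-* x (- x) ⟨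
    - (x * - x)      ≈⟨ -‿cong (-‿distribʳ-* x x) ⟨
    - - (x * x)      ≈⟨ -‿involutive (x * x) ⟩
    x * x            ≈⟨ *-congˡ (*-identityʳ x) ⟨
    x ^ 2            ∎

  T-via-square : ∀ x → T x ≈ x ^ 2 * x ^ 2 + x ^ 2 + 1#
  T-via-square = solve 1 (λ y → y :^ 4 :+ y :^ 2 :+ con 1 := y :^ 2 :* y :^ 2 :+ y :^ 2 :+ con 1) refl

  T-neg : ∀ x → T (- x) ≈ T x
  T-neg x = trans (T-via-square (- x)) (trans (+-congʳ (+-cong (*-cong sq sq) sq)) (sym (T-via-square x)))
    where sq = neg-square x

  neg*neg : ∀ x y → - x * - y ≈ x * y
  neg*neg x y = trans (sym (-‿distribˡ-* x (- y)))
    (trans (-‿cong (sym (-‿distribʳ-* x y))) (-‿involutive (x * y)))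

  -x*[-y]²≈-[x*y²] : ∀ x y → - x * (- y) ^ 2 ≈ - (x * y ^ 2)
  -x*[-y]²≈-[x*y²] x y = trans (*-congˡ (neg-square y)) (sym (-‿distribˡ-* x (y ^ 2)))

  x*-y≈-x*y : ∀ x y → x * - y ≈ - x * y
  x*-y≈-x*y x y = trans (sym (-‿distribʳ-* x y)) (-‿distribˡ-* x y)

  x*[-y]²≈-[-x*y²] : ∀ x y → x * (- y) ^ 2 ≈ - (- x * y ^ 2)
  x*[-y]²≈-[-x*y²] x y = trans (*-congʳ (sym (-‿involutive x))) (-x*[-y]²≈-[x*y²] (- x) y)

  unit-transpose : ∀ {u v x y} → u * v ≈ 1# → y ≈ u * x → v * y ≈ x
  unit-transpose {u} {v} {x} {y} uv≈1 y≈ux = trans (*-congˡ y≈ux)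
    (trans (sym (*-assoc v u x)) (trans (*-congʳ (trans (*-comm v u) uv≈1)) (*-identityˡ x)))

  module _ (d : Carrier) where

    -- The equation with the coefficients (1, 1, 1, d).
    Solves : Carrier → Carrier → Carrier → Set
    Solves x y z = 1# * x ^ 2 + 1# * y ^ 2 + 1# * z ^ 2 ≈ d * x * y * z

    private
      lhs : ∀ α β → 1# * α ^ 2 + 1# * (α * β) ^ 2 + 1# * (α * β ^ 2) ^ 2 ≈ α ^ 2 * T β
      lhs = solve 2 (λ α β → con 1 :* α :^ 2 :+ con 1 :* (α :* β) :^ 2 :+ con 1 :* (α :* β :^ 2) :^ 2
        := α :^ 2 :* (β :^ 4 :+ β :^ 2 :+ con 1)) refl

      rhs : ∀ α β → d * α * (α * β) * (α * β ^ 2) ≈ α ^ 2 * (d * α * β ^ 3)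
      rhs = solve 3 (λ d α β → d :* α :* (α :* β) :* (α :* β :^ 2)
        := α :^ 2 :* (d :* α :* β :^ 3)) refl d

    geometric-solves : ∀ {α β} → d * α * β ^ 3 ≈ T β → Solves α (α * β) (α * β ^ 2)
    geometric-solves {α} {β} eq = trans (lhs α β) (trans (*-congˡ (sym eq)) (sym (rhs α β)))

    solves-geometric : ∀ {α α⁻¹ β} → α * α⁻¹ ≈ 1# → Solves α (α * β) (α * β ^ 2) → d * α * β ^ 3 ≈ T β
    solves-geometric {α} {α⁻¹} {β} unit eq = cancel-unit (unit-^ unit 2)
      (trans (sym (rhs α β)) (trans (sym eq) (lhs α β)))

    ratio-inverse : ∀ {α β} → d * α * β ^ 3 ≈ T β → β * (d * α * β ^ 2 + - (β + β ^ 3)) ≈ 1#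
    ratio-inverse {α} {β} eq = begin
      β * (d * α * β ^ 2 + - s)         ≈⟨ distribˡ β (d * α * β ^ 2) (- s) ⟩
      β * (d * α * β ^ 2) + β * - s     ≈⟨ +-congʳ (solve 2 (λ x β → β :* (x :* β :^ 2) := x :* β :^ 3) refl (d * α) β) ⟩
      d * α * β ^ 3 + β * - s           ≈⟨ +-congʳ eq ⟩
      T β + β * - s                     ≈⟨ solve 2 (λ β m → β :^ 4 :+ β :^ 2 :+ con 1 :+ β :* m := con 1 :+ β :* (β :+ β :^ 3 :+ m)) refl β (- s) ⟩
      1# + β * (s + - s)                ≈⟨ +-congˡ (*-congˡ (-‿inverseʳ s)) ⟩
      1# + β * 0#                       ≈⟨ +-congˡ (zeroʳ β) ⟩
      1# + 0#                           ≈⟨ +-identityʳ 1# ⟩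
      1#                                ∎
      where s = β + β ^ 3

    module _ {d⁻¹ γ γ⁻¹ : Carrier} (d⁻¹d≈1 : d⁻¹ * d ≈ 1#) (γγ⁻¹≈1 : γ * γ⁻¹ ≈ 1#) where

      -- The first term (γ + γ⁻¹ + γ⁻³) / d of the solution of ratio γ.  The
      -- exponent 1 and the final 0 are those of a sum of three powers over
      -- j = 0, 1, 2.
      firstTerm : Carrier
      firstTerm = d⁻¹ * (γ ^ 1 + (γ⁻¹ ^ 1 + (γ⁻¹ ^ 3 + 0#)))

      firstTerm-equation : d * firstTerm * γ ^ 3 ≈ T γ
      firstTerm-equation = begin
        d * firstTerm * γ ^ 3
          ≈⟨ solve 4 (λ d e γ g → d :* (e :* (γ :^ 1 :+ (g :^ 1 :+ (g :^ 3 :+ con 0)))) :* γ :^ 3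
               := (e :* d) :* (γ :^ 4 :+ γ :^ 2 :* (γ :* g) :+ (γ :* g) :^ 3)) refl d d⁻¹ γ γ⁻¹ ⟩
        (d⁻¹ * d) * (γ ^ 4 + γ ^ 2 * (γ * γ⁻¹) + (γ * γ⁻¹) ^ 3)
          ≈⟨ *-cong d⁻¹d≈1 (+-cong (+-congˡ (trans (*-congˡ γγ⁻¹≈1) (*-identityʳ (γ ^ 2)))) (trans (^-congˡ 3 γγ⁻¹≈1) (1^ 3))) ⟩
        1# * T γ ≈⟨ *-identityˡ (T γ) ⟩
        T γ ∎

      -- The first term lies in every subring that contains T γ / d and γ⁻¹.
      firstTerm-from-quotient : ∀ {w} → T γ ≈ d * w → firstTerm ≈ w * γ⁻¹ ^ 3
      firstTerm-from-quotient {w} eq = cancel-unit (unit-^ γγ⁻¹≈1 3) (cancel-unit (trans (*-comm d d⁻¹) d⁻¹d≈1) (begin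
        d * (γ ^ 3 * firstTerm)        ≈⟨ solve 3 (λ d g x → d :* (g :* x) := d :* x :* g) refl d (γ ^ 3) firstTerm ⟩
        d * firstTerm * γ ^ 3          ≈⟨ firstTerm-equation ⟩
        T γ                            ≈⟨ eq ⟩
        d * w                          ≈⟨ *-congˡ (*-identityʳ w) ⟨
        d * (w * 1#)                   ≈⟨ *-congˡ (*-congˡ (unit-^ γγ⁻¹≈1 3)) ⟨
        d * (w * (γ ^ 3 * γ⁻¹ ^ 3))    ≈⟨ *-congˡ (solve 3 (λ w x y → w :* (x :* y) := x :* (w :* y)) refl w (γ ^ 3) (γ⁻¹ ^ 3)) ⟩
        d * (γ ^ 3 * (w * γ⁻¹ ^ 3))    ∎))

      firstTerm-unique : ∀ {α} → d * α * γ ^ 3 ≈ T γ → α ≈ firstTerm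
      firstTerm-unique {α} eq = cancel-unit (unit-^ γγ⁻¹≈1 3) (cancel-unit (trans (*-comm d d⁻¹) d⁻¹d≈1) (begin
        d * (γ ^ 3 * α)         ≈⟨ rearrange α ⟩
        d * α * γ ^ 3           ≈⟨ eq ⟩
        T γ                     ≈⟨ firstTerm-equation ⟨
        d * firstTerm * γ ^ 3   ≈⟨ rearrange firstTerm ⟨
        d * (γ ^ 3 * firstTerm) ∎))
        where
        rearrange : ∀ x → d * (γ ^ 3 * x) ≈ d * x * γ ^ 3
        rearrange x = solve 3 (λ d g x → d :* (g :* x) := d :* x :* g) refl d (γ ^ 3) x

    -- (α, β) and (- α, - β) satisfy the equation together: T is even, and α β³
    -- has even total degree.
    neg-geometric : ∀ {α β} → d * α * β ^ 3 ≈ T β → d * - α * (- β) ^ 3 ≈ T (- β)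
    neg-geometric {α} {β} eq = begin
      d * - α * (- β) ^ 3              ≈⟨ solve 4 (λ d a b s → d :* a :* (b :* s) := d :* (a :* b) :* s) refl d (- α) (- β) ((- β) ^ 2) ⟩
      d * (- α * - β) * (- β) ^ 2      ≈⟨ *-cong (*-congˡ (neg*neg α β)) (neg-square β) ⟩
      d * (α * β) * β ^ 2              ≈⟨ solve 4 (λ d a b s → d :* (a :* b) :* s := d :* a :* (b :* s)) refl d α β (β ^ 2) ⟩
      d * α * β ^ 3                    ≈⟨ eq ⟩
      T β                              ≈⟨ T-neg β ⟨
      T (- β)                          ∎

    neg-ratio-geometric : ∀ {α γ} → d * α * (- γ) ^ 3 ≈ T (- γ) → d * - α * γ ^ 3 ≈ T γ
    neg-ratio-geometric {α} {γ} eq = trans (*-congˡ (^-congˡ 3 (sym (-‿involutive γ))))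
      (trans (neg-geometric {α} { - γ} eq) (T-cong (-‿involutive γ)))

    geometric-vanishes : ∀ {α β} → d * α * β ^ 3 ≈ T β → α ≈ 0# → T β ≈ 0#
    geometric-vanishes {α} {β} eq α≈0 = trans (sym eq) (trans (*-congʳ (trans (*-congˡ α≈0) (zeroʳ d))) (zeroˡ (β ^ 3)))

    -- Congruences modulo d in a subring O that contains d.
    module Congruences
      (O : Carrier → Set)
      (O-resp : ∀ {x y} → x ≈ y → O x → O y)
      (O-1 : O 1#)
      (O-d : O d)
      (O-+ : ∀ {x y} → O x → O y → O (x + y))
      (O-neg : ∀ {x} → O x → O (- x))
      (O-* : ∀ {x y} → O x → O y → O (x * y))
      where

      O-^ : ∀ {x} k → O x → O (x ^ k)
      O-^ zero    Ox = O-1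
      O-^ (suc k) Ox = O-* Ox (O-^ k Ox)

      -- The multiples of d in O.
      Divisible : Carrier → Set
      Divisible x = ∃[ w ] O w × x ≈ d * w

      -- The class of 1 modulo d in O.
      CongruentToOne : Carrier → Set
      CongruentToOne x = ∃[ w ] O w × x ≈ 1# + d * w

      one-* : ∀ {x y} → CongruentToOne x → CongruentToOne y → CongruentToOne (x * y)
      one-* (w , Ow , eq) (w′ , Ow′ , eq′) =
        w + w′ + d * w * w′ , O-+ (O-+ Ow Ow′) (O-* (O-* O-d Ow) Ow′) ,
        trans (*-cong eq eq′) (solve 3 (λ d w v →
          (con 1 :+ d :* w) :* (con 1 :+ d :* v) := con 1 :+ d :* (w :+ v :+ d :* w :* v)) refl d w w′)

      one-^ : ∀ {x} k → CongruentToOne x → CongruentToOne (x ^ k)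
      one-^ zero    h = 0# , O-resp (-‿inverseʳ 1#) (O-+ O-1 (O-neg O-1)) , sym (trans (+-congˡ (zeroʳ d)) (+-identityʳ 1#))
      one-^ (suc k) h = one-* h (one-^ k h)

      one-inverse : ∀ {x y} → x * y ≈ 1# → O y → CongruentToOne x → CongruentToOne y
      one-inverse {x} {y} xy≈1 Oy (w , Ow , eq) = - (y * w) , O-neg (O-* Oy Ow) , (begin
        y                                       ≈⟨ +-identityʳ y ⟨
        y + 0#                                  ≈⟨ +-congˡ (zeroʳ d) ⟨
        y + d * 0#                              ≈⟨ +-congˡ (*-congˡ (-‿inverseʳ (y * w))) ⟨
        y + d * (y * w + - (y * w))             ≈⟨ solve 4 (λ d w y m → y :+ d :* (y :* w :+ m) := (con 1 :+ d :* w) :* y :+ d :* m) refl d w y (- (y * w)) ⟩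
        (1# + d * w) * y + d * - (y * w)        ≈⟨ +-congʳ (*-congʳ eq) ⟨
        x * y + d * - (y * w)                   ≈⟨ +-congʳ xy≈1 ⟩
        1# + d * - (y * w)                      ∎)

      one-difference : ∀ {x w} → O w → x - 1# ≈ d * w → CongruentToOne x
      one-difference {x} {w} Ow eq = w , Ow , (begin
        x                ≈⟨ +-identityʳ x ⟨
        x + 0#           ≈⟨ +-congˡ (-‿inverseˡ 1#) ⟨
        x + (- 1# + 1#)  ≈⟨ +-assoc x (- 1#) 1# ⟨
        x - 1# + 1#      ≈⟨ +-congʳ eq ⟩
        d * w + 1#       ≈⟨ +-comm (d * w) 1# ⟩
        1# + d * w       ∎)

      difference-divisible : ∀ {x y} → x ≈ y → Divisible x → ∃[ w ] O w × y - 0# ≈ d * w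
      difference-divisible {x} {y} x≈y (w , Ow , eq) = w , Ow ,
        trans (trans (+-congˡ -0#≈0#) (+-identityʳ y)) (trans (sym x≈y) eq)

      divisible-difference : ∀ {x y} → x ≈ y → (∃[ w ] O w × y - 0# ≈ d * w) → Divisible x
      divisible-difference {x} {y} x≈y (w , Ow , eq) = w , Ow ,
        trans x≈y (trans (sym (trans (+-congˡ -0#≈0#) (+-identityʳ y))) eq)

      -- When u is congruent to 1 modulo d, the difference of T (u y) and T y is a
      -- multiple of d.
      T-congruence : ∀ {u y} → CongruentToOne u → O y → Divisible (T y) → Divisible (T (u * y))
      T-congruence {u} {y} (w , Ow , eq) Oy (q , Oq , Ty≈dq) =
        q + w * E , O-+ Oq (O-* Ow O-E) , (begin
          T (u * y)            ≈⟨ T-cong (*-congʳ eq) ⟩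
          T ((1# + t) * y)     ≈⟨ expand t y ⟩
          T y + t * E          ≈⟨ +-congʳ Ty≈dq ⟩
          d * q + t * E        ≈⟨ solve 4 (λ d q w e → d :* q :+ d :* w :* e := d :* (q :+ w :* e)) refl d q w E ⟩
          d * (q + w * E)      ∎)
        where
        t = d * w
        a = (1# + t) * (1# + t)
        -- E = (T ((1 + t) y) - T y) / t, from a - 1 = t (2 + t)
        E = (1# + 1# + t) * y ^ 2 * ((a + 1#) * y ^ 2 + 1#)
        O-t = O-* O-d Ow
        O-a = O-* (O-+ O-1 O-t) (O-+ O-1 O-t)
        O-E = O-* (O-* (O-+ (O-+ O-1 O-1) O-t) (O-^ 2 Oy)) (O-+ (O-* (O-+ O-a O-1) (O-^ 2 Oy)) O-1)
        expand : ∀ t y → T ((1# + t) * y) ≈ T y + t * ((1# + 1# + t) * y ^ 2 * (((1# + t) * (1# + t) + 1#) * y ^ 2 + 1#))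
        expand = solve 2 (λ t y → ((con 1 :+ t) :* y) :^ 4 :+ ((con 1 :+ t) :* y) :^ 2 :+ con 1
          := (y :^ 4 :+ y :^ 2 :+ con 1) :+ t :* ((con 1 :+ con 1 :+ t) :* y :^ 2 :*
             (((con 1 :+ t) :* (con 1 :+ t) :+ con 1) :* y :^ 2 :+ con 1))) refl

      T-divisible-resp : ∀ {u x y} → CongruentToOne u → O x → y ≈ u * x → Divisible (T x) → Divisible (T y)
      T-divisible-resp {u} {x} {y} u≡1 Ox y≈ux div =
        let (w , Ow , eq) = T-congruence {u} {x} u≡1 Ox div
        in w , Ow , trans (T-cong {y} {u * x} y≈ux) eq

-- Rational numbers and their integers

open import Data.Integer.Base as ℤ using (ℤ; +_; -[1+_])
import Data.Integer.DivMod as ℤ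
import Data.Integer.Properties as ℤₚ
open import Data.Nat.Coprimality using (Coprime; coprime-divisor; recompute) renaming (sym to coprime-sym)
open import Data.Nat.Divisibility using (_∣_; divides; ∣-refl)
open import Data.Nat.Induction using (<-rec)
open import Data.Rational as ℚ using (ℚ; mkℚ; _/_; 0ℚ; 1ℚ; ½; ↥_; ↧_; ↧ₙ_; toℚᵘ)
import Data.Rational.Properties as ℚₚ
open import Data.Rational.Solver using (module +-*-Solver)
open import Data.Rational.Unnormalised.Base as ℚᵘ using (mkℚᵘ; *≡*)
import Data.Rational.Unnormalised.Properties as ℚᵘₚ
open import Relation.Binary.PropositionalEquality
  using (_≢_; refl; sym; trans; cong; cong₂; subst; module ≡-Reasoning)
open import Relation.Nullary using (yes; no; contradiction)
open import Relation.Unary using (_∈_; _≐_)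
open import Algebra.Properties.Semiring.Exp (CommutativeRing.semiring ℚₚ.+-*-commutativeRing)
  using () renaming (_^_ to _^ℚ_)
open ≡-Reasoning

-- The embedding of ℤ in ℚ.  It is opaque so that it does not unfold to a
-- division by a greatest common divisor.
opaque
  int : ℤ → ℚ
  int z = z / 1

  int≡ : ∀ z → int z ≡ z / 1
  int≡ z = refl

  toℚᵘ-int : ∀ z → toℚᵘ (int z) ℚᵘ.≃ mkℚᵘ z 0
  toℚᵘ-int z = ℚₚ.toℚᵘ-fromℚᵘ (mkℚᵘ z 0)

int-+ : ∀ a b → int (a ℤ.+ b) ≡ int a ℚ.+ int b
int-+ a b = ℚₚ.toℚᵘ-injective (ℚᵘₚ.≃-trans (toℚᵘ-int (a ℤ.+ b))
  (ℚᵘₚ.≃-trans (*≡* (cong (ℤ._* ℤ.1ℤ) (cong₂ ℤ._+_ (sym (ℤₚ.*-identityʳ a)) (sym (ℤₚ.*-identityʳ b)))))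
  (ℚᵘₚ.≃-sym (ℚᵘₚ.≃-trans (ℚₚ.toℚᵘ-homo-+ (int a) (int b))
    (ℚᵘₚ.+-cong (toℚᵘ-int a) (toℚᵘ-int b))))))

int-* : ∀ a b → int (a ℤ.* b) ≡ int a ℚ.* int b
int-* a b = ℚₚ.toℚᵘ-injective (ℚᵘₚ.≃-trans (toℚᵘ-int (a ℤ.* b))
  (ℚᵘₚ.≃-sym (ℚᵘₚ.≃-trans (ℚₚ.toℚᵘ-homo-* (int a) (int b))
    (ℚᵘₚ.*-cong (toℚᵘ-int a) (toℚᵘ-int b)))))

int-injective : ∀ {a b} → int a ≡ int b → a ≡ b
int-injective {a} {b} eq with ℚᵘₚ.≃-trans (ℚᵘₚ.≃-sym (toℚᵘ-int a)) (ℚᵘₚ.≃-trans (ℚᵘₚ.≃-reflexive (cong toℚᵘ eq)) (toℚᵘ-int b))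
... | *≡* e = ℤₚ.*-cancelʳ-≡ a b ℤ.1ℤ e

↧*r≡↥ : ∀ r → int (↧ r) ℚ.* r ≡ int (↥ r)
↧*r≡↥ r@(mkℚ n d-1 _) = ℚₚ.toℚᵘ-injective (ℚᵘₚ.≃-trans (ℚₚ.toℚᵘ-homo-* (int (↧ r)) r)
  (ℚᵘₚ.≃-trans (ℚᵘₚ.*-cong (toℚᵘ-int (↧ r)) (ℚᵘₚ.≃-refl {toℚᵘ r}))
  (ℚᵘₚ.≃-trans (*≡* lem) (ℚᵘₚ.≃-sym (toℚᵘ-int n)))))
  where
  lem : (↧ r ℤ.* n) ℤ.* ℤ.1ℤ ≡ n ℤ.* (ℤ.1ℤ ℤ.* ↧ r)
  lem = trans (ℤₚ.*-identityʳ _) (trans (ℤₚ.*-comm (↧ r) n) (cong (n ℤ.*_) (sym (ℤₚ.*-identityˡ (↧ r)))))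

-- The rationals that are integers.
Integer : ℚ → Set
Integer r = ∃[ z ] r ≡ int z

Integer-+ : ∀ {r s} → Integer r → Integer s → Integer (r ℚ.+ s)
Integer-+ (a , refl) (b , refl) = a ℤ.+ b , sym (int-+ a b)

Integer-* : ∀ {r s} → Integer r → Integer s → Integer (r ℚ.* s)
Integer-* (a , refl) (b , refl) = a ℤ.* b , sym (int-* a b)

Integer-int : ∀ z → Integer (int z)
Integer-int z = z , refl

int-neg : ∀ a → int (ℤ.- a) ≡ ℚ.- int a
int-neg a = ℚₚ.toℚᵘ-injective (ℚᵘₚ.≃-trans (toℚᵘ-int (ℤ.- a))
  (ℚᵘₚ.≃-sym (ℚᵘₚ.≃-trans (ℚₚ.toℚᵘ-homo‿- (int a)) (ℚᵘₚ.-‿cong (toℚᵘ-int a)))))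

Integer-neg : ∀ {r} → Integer r → Integer (ℚ.- r)
Integer-neg (a , refl) = ℤ.- a , sym (int-neg a)

-- The denominator divides every integer z with z r integral, by coprimality with
-- the numerator.
↧∣multiplier : ∀ z r → Integer (int z ℚ.* r) → ↧ₙ r ∣ ℤ.∣ z ∣
↧∣multiplier z r@(mkℚ n d-1 c) (w , eq) = coprime-divisor (coprime-sym (recompute c))
  (divides ℤ.∣ w ∣ (trans (sym (ℤₚ.abs-* n z)) (trans (cong ℤ.∣_∣ nz≡wd) (ℤₚ.abs-* w (↧ r)))))
  where
  nz≡wd : n ℤ.* z ≡ w ℤ.* ↧ r
  nz≡wd = int-injective (begin
    int (n ℤ.* z)                   ≡⟨ int-* n z ⟩
    int n ℚ.* int z                 ≡⟨ cong (ℚ._* int z) (↧*r≡↥ r) ⟨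
    int (↧ r) ℚ.* r ℚ.* int z       ≡⟨ solve 3 (λ a b c → a :* b :* c := (c :* b) :* a) refl (int (↧ r)) r (int z) ⟩
    (int z ℚ.* r) ℚ.* int (↧ r)     ≡⟨ cong (ℚ._* int (↧ r)) eq ⟩
    int w ℚ.* int (↧ r)             ≡⟨ int-* w (↧ r) ⟨
    int (w ℤ.* ↧ r)                 ∎)
    where open +-*-Solver

↧≡1⇒Integer : ∀ r → ↧ₙ r ≡ 1 → Integer r
↧≡1⇒Integer r eq = ↥ r , trans (sym (ℚₚ.*-identityˡ r))
  (trans (cong (ℚ._* r) (sym (int≡ (+ 1)))) (subst (λ d → int (+ d) ℚ.* r ≡ int (↥ r)) eq (↧*r≡↥ r)))

coprime-multipliers : ∀ {a b} r → Coprime ℤ.∣ a ∣ ℤ.∣ b ∣ →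
  Integer (int a ℚ.* r) → Integer (int b ℚ.* r) → Integer r
coprime-multipliers {a} {b} r c p q = ↧≡1⇒Integer r (c (↧∣multiplier a r p , ↧∣multiplier b r q))

numden-coprime : ∀ r → Coprime ℤ.∣ ↥ r ∣ (↧ₙ r)
numden-coprime (mkℚ n d-1 c) = recompute c

-- A rational whose powers have the common denominator e is an integer, by
-- descent on e: the denominator of r divides e, since e r is an integer, and the
-- quotient e′ is again a common denominator, since e′ r^k becomes an integer
-- both after multiplication by the numerator of r and by its denominator.
almostIntegral⇒Integer : ∀ r e → NonZero e → (∀ k → Integer (int (+ e) ℚ.* r ^ℚ k)) → Integer r
almostIntegral⇒Integer r = <-rec _ step
  where
  open +-*-Solver
  d = ↧ₙ r
  step : ∀ e → (∀ {e′} → e′ < e → NonZero e′ → (∀ k → Integer (int (+ e′) ℚ.* r ^ℚ k)) → Integer r) →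
         NonZero e → (∀ k → Integer (int (+ e) ℚ.* r ^ℚ k)) → Integer r
  step e rec e≢0 h with ↧∣multiplier (+ e) r (subst (λ s → Integer (int (+ e) ℚ.* s)) (ℚₚ.*-identityʳ r) (h 1))
  ... | divides e′ eq with d ℕₚ.≟ 1
  ...   | yes d≡1 = ↧≡1⇒Integer r d≡1
  ...   | no  d≢1 = rec e′<e e′≢0 λ k → coprime-multipliers {↥ r} {↧ r} _ (numden-coprime r)
            (subst Integer (n-step k) (h (suc k))) (subst Integer (d-step k) (h k))
    where
    e′≢0 : NonZero e′
    e′≢0 = ℕₚ.m*n≢0⇒m≢0 e′ {d} {{subst NonZero eq e≢0}}
    e′<e : e′ < e
    e′<e = subst (e′ <_) (sym eq) (ℕₚ.m<m*n e′ d {{e′≢0}} (ℕₚ.≤∧≢⇒< (s≤s z≤n) (λ x → d≢1 (sym x))))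
    e≡ : int (+ e) ≡ int (+ e′) ℚ.* int (↧ r)
    e≡ = trans (cong int (trans (cong +_ eq) (ℤₚ.pos-* e′ d))) (int-* (+ e′) (↧ r))
    d-step : ∀ k → int (+ e) ℚ.* r ^ℚ k ≡ int (↧ r) ℚ.* (int (+ e′) ℚ.* r ^ℚ k)
    d-step k = trans (cong (ℚ._* r ^ℚ k) e≡) (solve 3 (λ e d x → e :* d :* x := d :* (e :* x)) refl (int (+ e′)) (int (↧ r)) (r ^ℚ k))
    n-step : ∀ k → int (+ e) ℚ.* (r ℚ.* r ^ℚ k) ≡ int (↥ r) ℚ.* (int (+ e′) ℚ.* r ^ℚ k)
    n-step k = begin
      int (+ e) ℚ.* (r ℚ.* r ^ℚ k)                       ≡⟨ cong (ℚ._* (r ℚ.* r ^ℚ k)) e≡ ⟩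
      int (+ e′) ℚ.* int (↧ r) ℚ.* (r ℚ.* r ^ℚ k)         ≡⟨ solve 4 (λ e d r x → e :* d :* (r :* x) := d :* r :* (e :* x)) refl (int (+ e′)) (int (↧ r)) r (r ^ℚ k) ⟩
      int (↧ r) ℚ.* r ℚ.* (int (+ e′) ℚ.* r ^ℚ k)         ≡⟨ cong (ℚ._* (int (+ e′) ℚ.* r ^ℚ k)) (↧*r≡↥ r) ⟩
      int (↥ r) ℚ.* (int (+ e′) ℚ.* r ^ℚ k)              ∎

1/d*d≡1 : ∀ d .{{_ : NonZero d}} → (+ 1 / d) ℚ.* (+ d / 1) ≡ 1ℚ
1/d*d≡1 (suc d) = ℚₚ.toℚᵘ-injective (ℚᵘₚ.≃-trans (ℚₚ.toℚᵘ-homo-* (+ 1 / suc d) (+ suc d / 1))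
  (ℚᵘₚ.≃-trans (ℚᵘₚ.*-cong (ℚₚ.toℚᵘ-fromℚᵘ (mkℚᵘ (+ 1) d)) (ℚₚ.toℚᵘ-fromℚᵘ (mkℚᵘ (+ suc d) 0)))
    (*≡* (trans (ℤₚ.*-identityʳ (+ 1 ℤ.* + suc d)) (cong (λ n → + 1 ℤ.* + n) (sym (ℕₚ.*-identityʳ (suc d))))))))

square-nonNegative : ∀ p → ℚ.NonNegative (p ℚ.* p)
square-nonNegative p with ℚₚ.≤-total p 0ℚ
... | inj₁ p≤0 = ℚₚ.nonPos*nonPos⇒nonPos p {{ℚ.nonPositive p≤0}} p {{ℚ.nonPositive p≤0}}
... | inj₂ 0≤p = ℚₚ.nonNeg*nonNeg⇒nonNeg p {{ℚ.nonNegative 0≤p}} p {{ℚ.nonNegative 0≤p}}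

square≡0 : ∀ p → p ℚ.* p ≡ 0ℚ → p ≡ 0ℚ
square≡0 p p²≡0 with p ℚₚ.≟ 0ℚ
... | yes p≡0 = p≡0
... | no  p≢0 = begin
  p                             ≡⟨ ℚₚ.*-identityʳ p ⟨
  p ℚ.* 1ℚ                      ≡⟨ cong (p ℚ.*_) (ℚₚ.*-inverseʳ p {{nz}}) ⟨
  p ℚ.* (p ℚ.* ℚ.1/_ p {{nz}})  ≡⟨ ℚₚ.*-assoc p p _ ⟨
  p ℚ.* p ℚ.* ℚ.1/_ p {{nz}}    ≡⟨ cong (ℚ._* ℚ.1/_ p {{nz}}) p²≡0 ⟩
  0ℚ ℚ.* ℚ.1/_ p {{nz}}         ≡⟨ ℚₚ.*-zeroˡ (ℚ.1/_ p {{nz}}) ⟩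
  0ℚ                            ∎
  where nz = ℚ.≢-nonZero p≢0

-- The field ℚ(√D) and its ring of integers

-- From here on, unqualified operations are those of ℚ(√D), no longer those of an
-- abstract ring.
open import Defs

-- Since D = r² is an integer, so is r: its numerator and its denominator both
-- multiply it to an integer.  Then r² divides D.
squarefree-not-square : ∀ {D} → 1 < D → Squarefree D → ∀ r → r ℚ.* r ≢ int (+ D)
squarefree-not-square {D} 1<D sf r r²≡D = contradiction D≡1 (λ eq → ℕₚ.<-irrefl (sym eq) 1<D)
  where
  nr : int (↥ r) ℚ.* r ≡ int (↧ r ℤ.* + D)
  nr = begin
    int (↥ r) ℚ.* r          ≡⟨ cong (ℚ._* r) (↧*r≡↥ r) ⟨
    int (↧ r) ℚ.* r ℚ.* r     ≡⟨ ℚₚ.*-assoc (int (↧ r)) r r ⟩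
    int (↧ r) ℚ.* (r ℚ.* r)   ≡⟨ cong (int (↧ r) ℚ.*_) r²≡D ⟩
    int (↧ r) ℚ.* int (+ D)  ≡⟨ int-* (↧ r) (+ D) ⟨
    int (↧ r ℤ.* + D)        ∎
  r-integer : Integer r
  r-integer = coprime-multipliers {↥ r} {↧ r} r (numden-coprime r) (↧ r ℤ.* + D , nr) (↥ r , ↧*r≡↥ r)
  z = proj₁ r-integer
  z²≡D : ℤ.∣ z ∣ ℕ.* ℤ.∣ z ∣ ≡ D
  z²≡D = trans (sym (ℤₚ.abs-* z z)) (cong ℤ.∣_∣ (int-injective {z ℤ.* z} {+ D} (trans (int-* z z)
    (trans (sym (cong₂ ℚ._*_ (proj₂ r-integer) (proj₂ r-integer))) r²≡D))))
  D≡1 : D ≡ 1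
  D≡1 = trans (sym z²≡D) (cong (λ m → m ℕ.* m) (sf ℤ.∣ z ∣ (subst (ℤ.∣ z ∣ ℕ.* ℤ.∣ z ∣ ∣_) z²≡D ∣-refl)))

module _ {D : ℕ} where

  private
    K : Set
    K = ℚ√ D
    module KR = CommutativeRing (commutativeRing {D})

  ι-scale : ∀ r (x : K) → ι r * x ≡ (r ℚ.* rat x) +√ (r ℚ.* surd x)
  ι-scale r (p +√ q) = cong₂ _+√_
    (solve 4 (λ t r p q → r :* p :+ t :* (con 0ℚ :* q) := r :* p) refl (δ {D}) r p q)
    (solve 3 (λ r p q → r :* q :+ con 0ℚ :* p := r :* q) refl r p q)
    where open +-*-Solver

  ι-* : ∀ r s → ι {D} (r ℚ.* s) ≡ ι r * ι s
  ι-* r s = sym (trans (ι-scale r (ι s)) (cong ((r ℚ.* s) +√_) (ℚₚ.*-zeroʳ r)))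

  ι-^ : ∀ r k → ι {D} r ^ k ≡ ι (r ^ℚ k)
  ι-^ r zero = refl
  ι-^ r (suc k) = trans (cong (ι r *_) (ι-^ r k)) (sym (ι-* r (r ^ℚ k)))

  -- The embedding of ℕ in K.
  nat : ℕ → K
  nat e = ι (int (+ e))

  nat-* : ∀ a b → nat (a ℕ.* b) ≡ nat a * nat b
  nat-* a b = trans (cong ι (trans (cong int (ℤₚ.pos-* a b)) (int-* (+ a) (+ b)))) (ι-* (int (+ a)) (int (+ b)))

  -- The conjugate p - q√D of p + q√D.
  conj : K → K
  conj (p +√ q) = p +√ (ℚ.- q)

  conj-* : ∀ x y → conj (x * y) ≡ conj x * conj y
  conj-* (p +√ q) (r +√ s) = cong₂ _+√_
    (solve 5 (λ t p q r s → p :* r :+ t :* (q :* s) := p :* r :+ t :* ((:- q) :* (:- s))) refl (δ {D}) p q r s)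
    (solve 4 (λ p q r s → :- (p :* s :+ q :* r) := p :* (:- s) :+ (:- q) :* r) refl p q r s)
    where open +-*-Solver

  conj-^ : ∀ x k → conj (x ^ k) ≡ conj x ^ k
  conj-^ x zero = refl
  conj-^ x (suc k) = trans (conj-* x (x ^ k)) (cong (conj x *_) (conj-^ x k))

  x+conj : ∀ x → x + conj x ≡ ι (rat x ℚ.+ rat x)
  x+conj (p +√ q) = cong ((p ℚ.+ p) +√_) (ℚₚ.+-inverseʳ q)

  x*conj : ∀ x → x * conj x ≡ ι (norm x)
  x*conj (p +√ q) = cong₂ _+√_
    (solve 3 (λ t p q → p :* p :+ t :* (q :* (:- q)) := p :* p :- t :* (q :* q)) refl (δ {D}) p q)
    (solve 2 (λ p q → p :* (:- q) :+ q :* p := con 0ℚ) refl p q)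
    where open +-*-Solver

  -- The ring ℤ + ℤ√D, in general smaller than 𝒪.
  Lattice : K → Set
  Lattice x = Integer (rat x) × Integer (surd x)

  Lattice-+ : ∀ {x y} → Lattice x → Lattice y → Lattice (x + y)
  Lattice-+ (a , b) (c , d) = Integer-+ a c , Integer-+ b d

  Lattice-* : ∀ {x y} → Lattice x → Lattice y → Lattice (x * y)
  Lattice-* (a , b) (c , d) =
    Integer-+ (Integer-* a c) (Integer-* (+ D , sym (int≡ (+ D))) (Integer-* b d)) ,
    Integer-+ (Integer-* a d) (Integer-* b c)

  Lattice-neg : ∀ {x} → Lattice x → Lattice (- x)
  Lattice-neg (a , b) = Integer-neg a , Integer-neg b

  Lattice-conj : ∀ {x} → Lattice x → Lattice (conj x)
  Lattice-conj (a , b) = a , Integer-neg b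

  Lattice-ι : ∀ {r} → Integer r → Lattice (ι r)
  Lattice-ι r-int = r-int , (+ 0 , sym (int≡ (+ 0)))

  denominator : ∀ x → ∃[ e ] NonZero e × Lattice (nat e * x)
  denominator x@(p +√ q) = ↧ₙ p ℕ.* ↧ₙ q , ℕₚ.m*n≢0 (↧ₙ p) (↧ₙ q) ,
    subst Lattice (sym (ι-scale (int (+ (↧ₙ p ℕ.* ↧ₙ q))) x))
     ( subst Integer (sym p-eq) (Integer-* (Integer-int (↧ q)) (↥ p , ↧*r≡↥ p))
     , subst Integer (sym q-eq) (Integer-* (Integer-int (↧ p)) (↥ q , ↧*r≡↥ q)))
    where
    open +-*-Solver
    split : int (+ (↧ₙ p ℕ.* ↧ₙ q)) ≡ int (↧ p) ℚ.* int (↧ q)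
    split = trans (cong int (ℤₚ.pos-* (↧ₙ p) (↧ₙ q))) (int-* (↧ p) (↧ q))
    p-eq : int (+ (↧ₙ p ℕ.* ↧ₙ q)) ℚ.* p ≡ int (↧ q) ℚ.* (int (↧ p) ℚ.* p)
    p-eq = trans (cong (ℚ._* p) split) (solve 3 (λ a b p → a :* b :* p := b :* (a :* p)) refl (int (↧ p)) (int (↧ q)) p)
    q-eq : int (+ (↧ₙ p ℕ.* ↧ₙ q)) ℚ.* q ≡ int (↧ p) ℚ.* (int (↧ q) ℚ.* q)
    q-eq = trans (cong (ℚ._* q) split) (ℚₚ.*-assoc (int (↧ p)) (int (↧ q)) q)

  open AlmostIntegrality.WithLattice (commutativeRing {D}) Lattice (subst Lattice) (Lattice-ι (_ , sym (int≡ (+ 0))))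
    (λ {x} {y} → Lattice-+ {x} {y}) (λ {x} → Lattice-neg {x}) (λ {x} {y} → Lattice-* {x} {y})
    nat (λ e → Lattice-ι (Integer-int (+ e))) nat-* denominator

  𝒪⇒almostIntegral : ∀ {x} → x ∈ 𝒪 → AlmostIntegral x
  𝒪⇒almostIntegral (m , c , root) = integral⇒almostIntegral m _
    (λ i → Lattice-ι (c i , sym (int≡ (c i)))) root

  almostIntegral-conj : ∀ {x} → AlmostIntegral x → AlmostIntegral (conj x)
  almostIntegral-conj {x} (e , e≢0 , h) = e , e≢0 , λ k →
    subst Lattice (trans (conj-* (nat e) (x ^ k)) (cong (nat e *_) (conj-^ x k))) (Lattice-conj (h k))

  rational-almostIntegral⇒Integer : ∀ {r} → AlmostIntegral (ι r) → Integer r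
  rational-almostIntegral⇒Integer {r} (e , e≢0 , h) = almostIntegral⇒Integer r e e≢0 λ k →
    proj₁ (subst Lattice (trans (cong (nat e *_) (ι-^ r k)) (ι-scale (int (+ e)) (ι (r ^ℚ k)))) (h k))

  -- x is a root of X² - tX + n, where t is its trace and n its norm.
  integer-trace-norm⇒𝒪 : ∀ x → Integer (rat x ℚ.+ rat x) → Integer (norm x) → x ∈ 𝒪
  integer-trace-norm⇒𝒪 x@(p +√ q) (t , trace≡t) (n , norm≡n) = 2 , c , root
    where
    c : Fin 2 → ℤ
    c zero = n
    c (suc _) = ℤ.- t
    root : x ^ 2 + ∑[ i < 2 ] (ι (c i / 1) * x ^ toℕ i) ≡ 0K
    root = trans
      (cong₂ (λ n s → x ^ 2 + (n * 1K + (s * x ^ 1 + 0K)))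
        (sym (trans (x*conj x) (cong ι (trans norm≡n (int≡ n)))))
        (sym (trans (cong (-_ {D}) (x+conj x)) (cong ι (trans (cong ℚ.-_ trace≡t) (trans (sym (int-neg t)) (int≡ (ℤ.- t))))))))
      (RingIdentities.root-of-product (commutativeRing {D}) x (conj x))

  almostIntegral⇒𝒪 : ∀ {x} → AlmostIntegral x → x ∈ 𝒪
  almostIntegral⇒𝒪 {x} ai = integer-trace-norm⇒𝒪 x
    (rational-almostIntegral⇒Integer
      (subst AlmostIntegral (x+conj x) (almostIntegral-+ ai (almostIntegral-conj ai))))
    (rational-almostIntegral⇒Integer
      (subst AlmostIntegral (x*conj x) (almostIntegral-* ai (almostIntegral-conj ai))))

  𝒪-+ : ∀ {x y : K} → x ∈ 𝒪 → y ∈ 𝒪 → (x + y) ∈ 𝒪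
  𝒪-+ p q = almostIntegral⇒𝒪 (almostIntegral-+ (𝒪⇒almostIntegral p) (𝒪⇒almostIntegral q))

  𝒪-* : ∀ {x y : K} → x ∈ 𝒪 → y ∈ 𝒪 → (x * y) ∈ 𝒪
  𝒪-* p q = almostIntegral⇒𝒪 (almostIntegral-* (𝒪⇒almostIntegral p) (𝒪⇒almostIntegral q))

  -- Inverses, powers and units of ℚ(√D)

  norm-* : ∀ (x y : K) → norm (x * y) ≡ norm x ℚ.* norm y
  norm-* (p +√ q) (r +√ s) = solve 5 (λ t p q r s →
    (p :* r :+ t :* (q :* s)) :* (p :* r :+ t :* (q :* s)) :- t :* ((p :* s :+ q :* r) :* (p :* s :+ q :* r))
    := (p :* p :- t :* (q :* q)) :* (r :* r :- t :* (s :* s))) refl (δ {D}) p q r s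
    where open +-*-Solver

  norm-1 : norm {D} 1K ≡ 1ℚ
  norm-1 = solve 1 (λ t → con 1ℚ :* con 1ℚ :- t :* (con 0ℚ :* con 0ℚ) := con 1ℚ) refl (δ {D})
    where open +-*-Solver

  unit⇒norm≢0 : ∀ {u v : K} → u * v ≡ 1K → norm u ≢ 0ℚ
  unit⇒norm≢0 {u} {v} uv≡1 n≡0 = contradiction (begin
    1ℚ                 ≡⟨ norm-1 ⟨
    norm {D} 1K        ≡⟨ cong norm uv≡1 ⟨
    norm (u * v)       ≡⟨ norm-* u v ⟩
    norm u ℚ.* norm v  ≡⟨ cong (ℚ._* norm v) n≡0 ⟩
    0ℚ ℚ.* norm v      ≡⟨ ℚₚ.*-zeroˡ (norm v) ⟩
    0ℚ                 ∎) (λ ())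

  *-⁻¹ : ∀ {x : K} → norm x ≢ 0ℚ → x * x ⁻¹ ≡ 1K
  *-⁻¹ {x} n≢0 with norm x ℚₚ.≟ 0ℚ
  ... | yes n≡0 = contradiction n≡0 n≢0
  ... | no  n≢0 = begin
    x * (ι 1/N * conj x)    ≡⟨ KR.*-assoc x (ι 1/N) (conj x) ⟨
    x * ι 1/N * conj x      ≡⟨ cong (_* conj x) (KR.*-comm x (ι 1/N)) ⟩
    ι 1/N * x * conj x      ≡⟨ KR.*-assoc (ι 1/N) x (conj x) ⟩
    ι 1/N * (x * conj x)    ≡⟨ cong (ι 1/N *_) (x*conj x) ⟩
    ι 1/N * ι (norm x)      ≡⟨ ι-* 1/N (norm x) ⟨
    ι (1/N ℚ.* norm x)      ≡⟨ cong ι (ℚₚ.*-inverseˡ (norm x) {{ℚ.≢-nonZero n≢0}}) ⟩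
    1K                      ∎
    where 1/N = ℚ.1/_ (norm x) {{ℚ.≢-nonZero n≢0}}

  -- If p² = D q² with q nonzero, then D is the square of p / q.
  nonzero⇒norm≢0 : 1 < D → Squarefree D → ∀ {x : K} → x ≢ 0K → norm x ≢ 0ℚ
  nonzero⇒norm≢0 1<D sf {p +√ q} x≢0 n≡0 with q ℚₚ.≟ 0ℚ
  ... | yes refl = x≢0 (cong ι (square≡0 p (trans
    (solve 2 (λ t p → p :* p := p :* p :- t :* (con 0ℚ :* con 0ℚ)) refl (δ {D}) p) n≡0)))
    where open +-*-Solver
  ... | no  q≢0 = squarefree-not-square 1<D sf (p ℚ.* 1/q) (begin
    (p ℚ.* 1/q) ℚ.* (p ℚ.* 1/q)
      ≡⟨ solve 4 (λ t p q i → (p :* i) :* (p :* i) := (p :* p :- t :* (q :* q)) :* (i :* i) :+ t :* ((q :* i) :* (q :* i)))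
           refl (δ {D}) p q 1/q ⟩
    norm {D} (p +√ q) ℚ.* (1/q ℚ.* 1/q) ℚ.+ δ {D} ℚ.* ((q ℚ.* 1/q) ℚ.* (q ℚ.* 1/q))
      ≡⟨ cong₂ (λ n i → n ℚ.* (1/q ℚ.* 1/q) ℚ.+ δ {D} ℚ.* (i ℚ.* i)) n≡0 (ℚₚ.*-inverseʳ q {{ℚ.≢-nonZero q≢0}}) ⟩
    0ℚ ℚ.* (1/q ℚ.* 1/q) ℚ.+ δ {D} ℚ.* (1ℚ ℚ.* 1ℚ)
      ≡⟨ solve 2 (λ t i → con 0ℚ :* (i :* i) :+ t :* (con 1ℚ :* con 1ℚ) := t) refl (δ {D}) 1/q ⟩
    δ {D}
      ≡⟨ int≡ (+ D) ⟨
    int (+ D) ∎)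
    where
    open +-*-Solver
    1/q = ℚ.1/_ q {{ℚ.≢-nonZero q≢0}}

  -- For s = p + q√D the rational part is (p + 1/2)² + D q² + 3/4 > 0.
  s²+s+1≢0 : ∀ (s : K) → s * s + s + 1K ≢ 0K
  s²+s+1≢0 (p +√ q) eq = ℚₚ.<-irrefl (sym (trans (sym complete-square) (cong rat eq)))
    (ℚₚ.positive⁻¹ _ {{ℚₚ.nonNeg+pos⇒pos (y ℚ.* y ℚ.+ δ {D} ℚ.* (q ℚ.* q)) {{nonNeg}} (+ 3 / 4)}})
    where
    open +-*-Solver
    y = p ℚ.+ ½
    nonNeg : ℚ.NonNegative (y ℚ.* y ℚ.+ δ {D} ℚ.* (q ℚ.* q))
    nonNeg = ℚₚ.nonNeg+nonNeg⇒nonNeg (y ℚ.* y) {{square-nonNegative y}} (δ {D} ℚ.* (q ℚ.* q))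
      {{ℚₚ.nonNeg*nonNeg⇒nonNeg (δ {D}) {{ℚₚ.normalize-nonNeg D 1}} (q ℚ.* q) {{square-nonNegative q}}}}
    complete-square : rat {D} ((p +√ q) * (p +√ q) + (p +√ q) + 1K) ≡ (y ℚ.* y ℚ.+ δ {D} ℚ.* (q ℚ.* q)) ℚ.+ (+ 3 / 4)
    complete-square = solve 3 (λ t p q → p :* p :+ t :* (q :* q) :+ p :+ con 1ℚ
      := ((p :+ con ½) :* (p :+ con ½) :+ t :* (q :* q)) :+ con (+ 3 / 4)) refl (δ {D}) p q

  Lattice⇒𝒪 : ∀ {x : K} → Lattice x → x ∈ 𝒪
  Lattice⇒𝒪 {x} Lx = almostIntegral⇒𝒪 (1 , _ , λ k → Lattice-* {x = nat 1} {x ^ k} (Lattice-ι (Integer-int (+ 1))) (power k))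
    where
    power : ∀ k → Lattice (x ^ k)
    power zero    = Lattice-ι (+ 1 , sym (int≡ (+ 1)))
    power (suc k) = Lattice-* {x = x} {x ^ k} Lx (power k)

  ι-integer∈𝒪 : ∀ z → ι {D} (z / 1) ∈ 𝒪
  ι-integer∈𝒪 z = Lattice⇒𝒪 (Lattice-ι (z , sym (int≡ z)))

  1∈𝒪 : 1K {D} ∈ 𝒪
  1∈𝒪 = ι-integer∈𝒪 (+ 1)

  𝒪-neg : ∀ {x : K} → x ∈ 𝒪 → (- x) ∈ 𝒪
  𝒪-neg {x} Ox = subst 𝒪 (-1*x≈-x x) (𝒪-* (ι-integer∈𝒪 (ℤ.- + 1)) Ox)
    where open import Algebra.Properties.Ring KR.ring using (-1*x≈-x)

  open GeometricSolutions (commutativeRing {D})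

  T≢0 : ∀ (x : K) → T x ≢ 0K
  T≢0 x eq = s²+s+1≢0 (x ^ 2) (trans (sym (T-via-square x)) eq)

  ^ℤ-⊖ : ∀ {u : K} → u * u ⁻¹ ≡ 1K → ∀ a b → u ^ℤ (a ℤ.⊖ b) ≡ u ^ a * (u ⁻¹) ^ b
  ^ℤ-⊖ {u} unit a zero = sym (KR.*-identityʳ (u ^ a))
  ^ℤ-⊖ {u} unit zero (suc b) = sym (KR.*-identityˡ ((u ⁻¹) ^ suc b))
  ^ℤ-⊖ {u} unit (suc a) (suc b) = begin
    u ^ℤ (suc a ℤ.⊖ suc b)             ≡⟨ cong (u ^ℤ_) (ℤₚ.[1+m]⊖[1+n]≡m⊖n a b) ⟩
    u ^ℤ (a ℤ.⊖ b)                     ≡⟨ ^ℤ-⊖ unit a b ⟩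
    u ^ a * (u ⁻¹) ^ b                 ≡⟨ unit-cancels {u} {u ⁻¹} unit (u ^ a) ((u ⁻¹) ^ b) ⟨
    u ^ suc a * (u ⁻¹) ^ suc b         ∎

  unit⇒*-⁻¹ : ∀ {u v : K} → u * v ≡ 1K → u * u ⁻¹ ≡ 1K
  unit⇒*-⁻¹ {u} {v} uv≡1 = *-⁻¹ {u} (unit⇒norm≢0 {u} {v} uv≡1)

  𝒰-inverse : ∀ {u : K} → u ∈ 𝒰 → u * u ⁻¹ ≡ 1K × u ⁻¹ ∈ 𝒪
  𝒰-inverse {u} (_ , v , Ov , uv≡1) =
    uu⁻¹≡1 , subst 𝒪 (inverse-unique {u} {v} {u ⁻¹} uv≡1 uu⁻¹≡1) Ov
    where uu⁻¹≡1 = unit⇒*-⁻¹ {u} {v} uv≡1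

-- The solutions over the ring of integers of ℚ(√D)

module _ (d : ℕ) .{{_ : NonZero d}} (D : ℕ) (1<D : 1 < D) (sf : Squarefree D)
  (ε : ℚ√ D) (fundamental : IsFundamentalUnit ε) (n : ℕ) (order : IsOrderOfClass d ε n) where

  private
    K : Set
    K = ℚ√ D
    module KR = CommutativeRing (commutativeRing {D})
    dK d⁻¹ : K
    dK = ι (+ d / 1)
    d⁻¹ = ι (+ 1 / d)

  open GeometricSolutions (commutativeRing {D})
  open Congruences dK 𝒪 (subst 𝒪) 1∈𝒪 (ι-integer∈𝒪 (+ d))
    (λ {x} {y} → 𝒪-+ {D} {x} {y}) (λ {x} → 𝒪-neg {D} {x}) (λ {x} {y} → 𝒪-* {D} {x} {y})
  open import Algebra.Properties.Semiring.Exp KR.semiring using (^-homo-*; ^-assocʳ)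
  open import Algebra.Properties.Group KR.+-group using (⁻¹-involutive; ε⁻¹≈ε)

  d⁻¹d≡1 : d⁻¹ * dK ≡ 1K
  d⁻¹d≡1 = trans (sym (ι-* (+ 1 / d) (+ d / 1))) (cong ι (1/d*d≡1 d))

  power∈𝒰 : ∀ m → ε ^ℤ m ∈ 𝒰
  power∈𝒰 m = proj₂ fundamental (m , inj₁ refl)

  ε∈𝒰 : ε ∈ 𝒰
  ε∈𝒰 = subst 𝒰 (KR.*-identityʳ ε) (power∈𝒰 (+ 1))

  εε⁻¹≡1 : ε * ε ⁻¹ ≡ 1K
  εε⁻¹≡1 = proj₁ (𝒰-inverse {u = ε} ε∈𝒰)

  ε^n≡1 : CongruentToOne (ε ^ n)
  ε^n≡1 = let (_ , (w , Ow , eq) , _) = order in one-difference {ε ^ n} {w} Ow eq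

  ε⁻^n≡1 : CongruentToOne ((ε ⁻¹) ^ n)
  ε⁻^n≡1 = one-inverse {ε ^ n} {(ε ⁻¹) ^ n} (unit-^ {ε} {ε ⁻¹} εε⁻¹≡1 n)
    (O-^ {ε ⁻¹} n (proj₂ (𝒰-inverse {u = ε} ε∈𝒰))) ε^n≡1

  -- A factorisation ε^(nz+k) = u ε^k, with a unit u such that u and its inverse v
  -- are 1 modulo d; periodFactor takes u = ε^(nz).
  PeriodFactor : ℤ → ℕ → Set
  PeriodFactor z k = ∃[ u ] ∃[ v ] CongruentToOne u × CongruentToOne v × u * v ≡ 1K
    × ε ^ℤ (+ n ℤ.* z ℤ.+ + k) ≡ u * ε ^ k

  one-^-multiple : ∀ {x} a → CongruentToOne (x ^ n) → CongruentToOne (x ^ (n ℕ.* a))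
  one-^-multiple {x} a h = subst CongruentToOne (^-assocʳ x n a) (one-^ {x ^ n} a h)

  periodFactor : ∀ z k → PeriodFactor z k
  periodFactor (+ a) k = ε ^ N , (ε ⁻¹) ^ N , one-^-multiple {ε} a ε^n≡1 , one-^-multiple {ε ⁻¹} a ε⁻^n≡1 ,
    unit-^ {ε} {ε ⁻¹} εε⁻¹≡1 N , (begin
      ε ^ℤ (+ n ℤ.* + a ℤ.+ + k)    ≡⟨ cong (λ i → ε ^ℤ (i ℤ.+ + k)) (ℤₚ.pos-* n a) ⟨
      ε ^ (N ℕ.+ k)                 ≡⟨ ^-homo-* ε N k ⟩
      ε ^ N * ε ^ k                 ∎)
    where N = n ℕ.* a
  periodFactor -[1+ a ] k = (ε ⁻¹) ^ N , ε ^ N , one-^-multiple {ε ⁻¹} (suc a) ε⁻^n≡1 , one-^-multiple {ε} (suc a) ε^n≡1 ,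
    trans (KR.*-comm ((ε ⁻¹) ^ N) (ε ^ N)) (unit-^ {ε} {ε ⁻¹} εε⁻¹≡1 N) , (begin
      ε ^ℤ (+ n ℤ.* -[1+ a ] ℤ.+ + k)    ≡⟨ cong (λ i → ε ^ℤ (i ℤ.+ + k)) (trans (sym (ℤₚ.neg-distribʳ-* (+ n) (+ suc a))) (cong ℤ.-_ (sym (ℤₚ.pos-* n (suc a))))) ⟩
      ε ^ℤ (ℤ.- (+ N) ℤ.+ + k)           ≡⟨ cong (ε ^ℤ_) (ℤₚ.-m+n≡n⊖m N k) ⟩
      ε ^ℤ (k ℤ.⊖ N)                     ≡⟨ ^ℤ-⊖ {u = ε} εε⁻¹≡1 k N ⟩
      ε ^ k * (ε ⁻¹) ^ N                 ≡⟨ KR.*-comm (ε ^ k) ((ε ⁻¹) ^ N) ⟩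
      (ε ⁻¹) ^ N * ε ^ k                 ∎)
    where N = n ℕ.* suc a

  ℋ⇒divisible : ∀ {k} → k ∈ ℋ d ε n → Divisible (T (ε ^ k))
  ℋ⇒divisible {k} (_ , div) = divisible-difference {T (ε ^ k)} (T-of-power ε k) div

  divisible⇒ℋ : ∀ {k} → k ℕ.≤ n → Divisible (T (ε ^ k)) → k ∈ ℋ d ε n
  divisible⇒ℋ {k} k≤n div = k≤n , difference-divisible {T (ε ^ k)} (T-of-power ε k) div

  divisible-periodic⇒ : ∀ z k → Divisible (T (ε ^ k)) → Divisible (T (ε ^ℤ (+ n ℤ.* z ℤ.+ + k)))
  divisible-periodic⇒ z k div =
    let (u , v , u≡1 , v≡1 , uv≡1 , γ≡) = periodFactor z k in
    T-divisible-resp {u} {ε ^ k} {ε ^ℤ (+ n ℤ.* z ℤ.+ + k)} u≡1 (O-^ {ε} k (proj₁ ε∈𝒰)) γ≡ div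

  divisible-periodic⇐ : ∀ z k → Divisible (T (ε ^ℤ (+ n ℤ.* z ℤ.+ + k))) → Divisible (T (ε ^ k))
  divisible-periodic⇐ z k div =
    let (u , v , u≡1 , v≡1 , uv≡1 , γ≡) = periodFactor z k in
    T-divisible-resp {v} {γ} {ε ^ k} v≡1 (proj₁ (power∈𝒰 (+ n ℤ.* z ℤ.+ + k)))
      (sym (unit-transpose {u} {v} {ε ^ k} {γ} uv≡1 γ≡)) div
    where γ = ε ^ℤ (+ n ℤ.* z ℤ.+ + k)

  γγ⁻¹≡1 : ∀ m → ε ^ℤ m * (ε ^ℤ m) ⁻¹ ≡ 1K
  γγ⁻¹≡1 m = proj₁ (𝒰-inverse {u = ε ^ℤ m} (power∈𝒰 m))

  geometric∈𝒢𝒫 : ∀ {α β y z} → α ∈ 𝒪 → β ∈ 𝒪 → α ≢ 0K → dK * α * β ^ 3 ≡ T β →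
    y ≡ α * β → z ≡ α * β ^ 2 → (α , y , z) ∈ 𝒢𝒫 1K 1K 1K dK
  geometric∈𝒢𝒫 {α} {β} Oα Oβ α≢0 eq refl refl =
    (Oα , 𝒪-* {x = α} Oα Oβ , 𝒪-* {x = α} Oα (O-^ {β} 2 Oβ)) ,
    (α , β , Oα , Oβ , α≢0 , refl , refl , refl) ,
    geometric-solves dK {α} {β} eq

  signPair⊆𝒢𝒫 : ∀ {α β t} → α ∈ 𝒪 → β ∈ 𝒪 → α ≢ 0K → dK * α * β ^ 3 ≡ T β →
    signPair α β t → t ∈ 𝒢𝒫 1K 1K 1K dK
  signPair⊆𝒢𝒫 {α} {β} Oα Oβ α≢0 eq (inj₁ refl) = geometric∈𝒢𝒫 {α} {β} Oα Oβ α≢0 eq refl refl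
  signPair⊆𝒢𝒫 {α} {β} Oα Oβ α≢0 eq (inj₂ refl) =
    geometric∈𝒢𝒫 { - α} { - β} (𝒪-neg {x = α} Oα) (𝒪-neg {x = β} Oβ)
      (λ -α≡0 → α≢0 (trans (sym (⁻¹-involutive α)) (trans (cong (-_ {D}) -α≡0) ε⁻¹≈ε)))
      (neg-geometric dK {α} {β} eq)
      (sym (neg*neg α β)) (sym (-x*[-y]²≈-[x*y²] α β))

  signPair-cong : ∀ {a b γ : K} {t} → a ≡ b → signPair a γ t → signPair b γ t
  signPair-cong refl pair = pair

  -- Solutions whose ratio is, up to sign, the power γ of ε.  Here k ∈ ℋ because
  -- T γ is d times the element a γ³ of 𝒪.
  ∈solutionSet : ∀ z k → k ℕ.≤ n → let γ = ε ^ℤ (+ n ℤ.* z ℤ.+ + k) in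
    ∀ {a t} → a ∈ 𝒪 → dK * a * γ ^ 3 ≡ T γ → signPair a γ t → t ∈ solutionSet d ε n
  ∈solutionSet z k k≤n {a} {t} Oa geo pair = (k , divisible⇒ℋ k≤n (divisible-periodic⇐ z k divisible)) , z ,
    signPair-cong {a} {β[ d ] γ} {γ} {t} (firstTerm-unique dK {d⁻¹} {γ} {γ ⁻¹} d⁻¹d≡1 (γγ⁻¹≡1 m) {a} geo) pair
    where
    m = + n ℤ.* z ℤ.+ + k
    γ : K
    γ = ε ^ℤ m
    divisible : Divisible (T γ)
    divisible = a * γ ^ 3 , 𝒪-* {x = a} Oa (O-^ {γ} 3 (proj₁ (power∈𝒰 m))) ,
      trans (sym geo) (KR.*-assoc dK a (γ ^ 3))

  reduce-exponent : ∀ m → ∃[ z ] ∃[ k ] k ℕ.≤ n × m ≡ + n ℤ.* z ℤ.+ + k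
  reduce-exponent m = m ℤ./ℕ n , m ℤ.%ℕ n , ℕₚ.<⇒≤ (ℤ.n%ℕd<d m n) ,
    trans (ℤ.a≡a%ℕn+[a/ℕn]*n m n)
      (trans (ℤₚ.+-comm (+ (m ℤ.%ℕ n)) (m ℤ./ℕ n ℤ.* + n)) (cong (ℤ._+ + (m ℤ.%ℕ n)) (ℤₚ.*-comm (m ℤ./ℕ n) (+ n))))
    where
    instance
      n≢0 : NonZero n
      n≢0 = ℕ.>-nonZero (proj₁ order)

  forward : ∀ {t} → t ∈ 𝒢𝒫 1K 1K 1K dK → t ∈ solutionSet d ε n
  forward (_ , (α , β , Oα , Oβ , α≢0 , refl , refl , refl) , eq) =
    let (m , β≡±ε^m) = proj₁ fundamental β∈𝒰 in locate (reduce-exponent m) β≡±ε^m geo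
    where
    geo : dK * α * β ^ 3 ≡ T β
    geo = solves-geometric dK {α} {α ⁻¹} {β} (*-⁻¹ {x = α} (nonzero⇒norm≢0 1<D sf {α} α≢0)) eq
    β∈𝒰 : β ∈ 𝒰
    β∈𝒰 = Oβ , dK * α * β ^ 2 - (β + β ^ 3) ,
      𝒪-+ {x = dK * α * β ^ 2} (𝒪-* {x = dK * α} (𝒪-* {x = dK} (ι-integer∈𝒪 (+ d)) Oα) (O-^ {β} 2 Oβ))
        (𝒪-neg {x = β + β ^ 3} (𝒪-+ {x = β} Oβ (O-^ {β} 3 Oβ))) ,
      ratio-inverse dK {α} {β} geo
    locate : ∀ {β m} → ∃[ z ] ∃[ k ] k ℕ.≤ n × m ≡ + n ℤ.* z ℤ.+ + k → (β ≡ ε ^ℤ m ⊎ β ≡ - (ε ^ℤ m)) →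
      dK * α * β ^ 3 ≡ T β → (α , α * β , α * β ^ 2) ∈ solutionSet d ε n
    locate (z , k , k≤n , refl) (inj₁ refl) geo = ∈solutionSet z k k≤n {α} Oα geo (inj₁ refl)
    -- The triple of first term α and ratio - γ is the second one of the sign pair
    -- of - α and γ.
    locate (z , k , k≤n , refl) (inj₂ refl) geo = ∈solutionSet z k k≤n { - α} (𝒪-neg {x = α} Oα)
      (neg-ratio-geometric dK {α} {γ} geo)
      (inj₂ (cong₂ _,_ (sym (⁻¹-involutive α)) (cong₂ _,_ (x*-y≈-x*y α γ) (x*[-y]²≈-[-x*y²] α γ))))
      where
      γ : K
      γ = ε ^ℤ (+ n ℤ.* z ℤ.+ + k)

  -- T γ ≡ 0 modulo d puts the first term in 𝒪, and T γ ≢ 0 makes it nonzero.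
  backward : ∀ {t} → t ∈ solutionSet d ε n → t ∈ 𝒢𝒫 1K 1K 1K dK
  backward {t} ((k , k∈ℋ) , z , pair) = signPair⊆𝒢𝒫 {α} {γ} {t} Oα Oγ α≢0 geo pair
    where
    m = + n ℤ.* z ℤ.+ + k
    γ α : K
    γ = ε ^ℤ m
    α = β[ d ] γ
    Oγ : γ ∈ 𝒪
    Oγ = proj₁ (power∈𝒰 m)
    geo : dK * α * γ ^ 3 ≡ T γ
    geo = firstTerm-equation dK {d⁻¹} {γ} {γ ⁻¹} d⁻¹d≡1 (γγ⁻¹≡1 m)
    Oα : α ∈ 𝒪
    Oα = let (w , Ow , eq) = divisible-periodic⇒ z k (ℋ⇒divisible k∈ℋ) in
      subst 𝒪 {w * (γ ⁻¹) ^ 3} {α}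
        (sym (firstTerm-from-quotient dK {d⁻¹} {γ} {γ ⁻¹} d⁻¹d≡1 (γγ⁻¹≡1 m) {w} eq))
        (𝒪-* {x = w} Ow (O-^ {γ ⁻¹} 3 (proj₂ (𝒰-inverse {u = γ} (power∈𝒰 m)))))
    α≢0 : α ≢ 0K
    α≢0 α≡0 = T≢0 γ (geometric-vanishes dK {α} {γ} geo α≡0)

theorem4p8 : (d : ℕ) .{{_ : NonZero d}} (D : ℕ) → 1 < D → Squarefree D →
    (ε : ℚ√ D) → IsFundamentalUnit ε →
    (n : ℕ) → IsOrderOfClass d ε n →
    𝒢𝒫 1K 1K 1K (ι (+ d / 1)) ≐ solutionSet d ε n
theorem4p8 d D 1<D sf ε fundamental n order =
  (λ {t} → forward d D 1<D sf ε fundamental n order {t}) ,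
  (λ {t} → backward d D 1<D sf ε fundamental n order {t})
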